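{- Let $D$ be a digraph of order $n$ and $2\le k\le n$. Then $\lambda_k(D)\le \lambda(D)$. Moreover, the bound is sharp.
   Context: Digraphs are finite, without loops or parallel arcs. $\lambda(D)$ is the arc-strong connectivity of $D$ (the minimum number of arcs whose deletion leaves a non-strong digraph). For $S\subseteq V(D)$, $\lambda_S(D)$ is the maximum number of pairwise arc-disjoint strong subgraphs of $D$ containing $S$, and $\lambda_k(D)=\min\{\lambda_S(D): S\subseteq V(D), |S|=k\}$. -}

module Defs where

open import Data.Fin using (Fin; zero; suc; combine)
open import Data.Fin.Properties using (all?; injective⇒≤) renaming (_≟_ to _≟ᶠ_)
open import Data.Fin.Subset using (Subset; inside; outside; _∈_; _∉_; _⊆_; _∩_; _─_; ∣_∣; ⊤; Nonempty; Empty)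
open import Data.Fin.Subset.Properties using (_∈?_; _⊆?_; anySubset?; nonempty?; ∈⊤; x∈p∩q⁺; p─q⊆p)
open import Data.List using (List; []; _∷_; allFin)
open import Data.List.Membership.Propositional using () renaming (_∈_ to _∈ˡ_)
open import Data.List.Membership.Propositional.Properties using (∈-allFin)
open import Data.List.Relation.Unary.Any using (here; there)
open import Data.Nat using (ℕ; zero; suc; _*_; _≤_; z≤n; s≤s; _≟_)
open import Data.Nat.Properties using (≤-antisym; ≤∧≢⇒<; ≤-pred)
open import Data.Product using (Σ; ∃; ∃₂; _×_; _,_; proj₁; proj₂)
open import Data.Sum using (_⊎_; inj₁; inj₂)
open import Data.Vec using (Vec; []; _∷_; lookup; tabulate)
open import Data.Vec.Base using (here; there)
open import Data.Vec.Properties using (lookup∘tabulate)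
open import Function using (_∘_)
open import Relation.Binary using () renaming (Decidable to Decidable₂)
open import Relation.Binary.Construct.Closure.ReflexiveTransitive using (Star; ε; _◅_; _◅◅_)
open import Relation.Binary.PropositionalEquality using (_≡_; _≢_; refl; sym; cong; subst; subst₂)
open import Relation.Nullary using (¬_; Dec; yes; no; contradiction)
open import Relation.Nullary.Decidable using (map′; ¬?; _×-dec_; _⊎-dec_; _→-dec_)
open import Relation.Unary using (Decidable)

-- A set of arcs on the vertex set Fin n; the arc from u to v is the element
-- combine u v of Fin (n * n), so ∣_∣ counts arcs and parallel arcs cannot occur.
ArcSet : ℕ → Set
ArcSet n = Subset (n * n)

Arc : ∀ {n} → ArcSet n → Fin n → Fin n → Set
Arc A u v = combine u v ∈ A

record Digraph (n : ℕ) : Set where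
  field
    arcs     : ArcSet n
    loopless : ∀ (u : Fin n) → ¬ Arc arcs u u

open Digraph public

record Subgraph (n : ℕ) : Set where
  constructor mkSubgraph
  field
    vertices : Subset n
    arcsOf   : ArcSet n

open Subgraph public

_IsSubgraphOf_ : ∀ {n} → Subgraph n → Digraph n → Set
H IsSubgraphOf D =
  ∀ u v → Arc (arcsOf H) u v → Arc (arcs D) u v × u ∈ vertices H × v ∈ vertices H

-- Strong connectivity of the digraph with vertex set V and arc set A,
-- where A is assumed to have all its end-vertices in V.
StronglyConnected : ∀ {n} → Subset n → ArcSet n → Set
StronglyConnected V A = ∀ u v → u ∈ V → v ∈ V → Star (Arc A) u v

StrongSubgraph : ∀ {n} → Subgraph n → Set
StrongSubgraph H = StronglyConnected (vertices H) (arcsOf H)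

Strong : ∀ {n} → Digraph n → Set
Strong {n} D = StronglyConnected {n} ⊤ (arcs D)

deleteArcs : ∀ {n} → Digraph n → ArcSet n → Digraph n
deleteArcs D A .arcs       = arcs D ─ A
deleteArcs D A .loopless u = loopless D u ∘ p─q⊆p (arcs D) A

ArcDisjoint : ∀ {n} → Subgraph n → Subgraph n → Set
ArcDisjoint H K = Empty (arcsOf H ∩ arcsOf K)

IsMinimum : (ℕ → Set) → ℕ → Set
IsMinimum P m = P m × (∀ m′ → P m′ → m ≤ m′)

IsMaximum : (ℕ → Set) → ℕ → Set
IsMaximum P m = P m × (∀ m′ → P m′ → m′ ≤ m)

ArcCutOfSize : ∀ {n} → Digraph n → ℕ → Set
ArcCutOfSize {n} D m =
  Σ (ArcSet n) λ A → A ⊆ arcs D × ∣ A ∣ ≡ m × ¬ Strong (deleteArcs D A)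

PackingOfSize : ∀ {n} → Digraph n → Subset n → ℕ → Set
PackingOfSize {n} D S m = Σ (Fin m → Subgraph n) λ H →
  (∀ i → H i IsSubgraphOf D × StrongSubgraph (H i) × S ⊆ vertices (H i)) ×
  (∀ i j → i ≢ j → ArcDisjoint (H i) (H j))

-- Is-λ D l, Is-λS D S l, Is-λk D k l state that l is λ(D), λ_S(D), λ_k(D).
Is-λ : ∀ {n} → Digraph n → ℕ → Set
Is-λ D = IsMinimum (ArcCutOfSize D)

Is-λS : ∀ {n} → Digraph n → Subset n → ℕ → Set
Is-λS D S = IsMaximum (PackingOfSize D S)

Is-λk : ∀ {n} → Digraph n → ℕ → ℕ → Set
Is-λk {n} D k = IsMinimum λ m → Σ (Subset n) λ S → ∣ S ∣ ≡ k × Is-λS D S m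

-- The rest of the file shows that these minima and maxima exist
-- (and so defines λ and λ_k as numbers) when 2 ≤ k ≤ n.

minimum : ∀ {P : ℕ → Set} → Decidable P → ∀ m → P m → ∃ (IsMinimum P)
minimum P? m pm with P? 0
minimum P? m       pm | yes p0 = 0 , p0 , λ _ _ → z≤n
minimum P? zero    pm | no ¬p0 = contradiction pm ¬p0
minimum P? (suc m) pm | no ¬p0 with minimum (P? ∘ suc) m pm
... | l , pl , min = suc l , pl , λ where
  zero     p → contradiction p ¬p0
  (suc m′) p → s≤s (min m′ p)

maximum : ∀ {P : ℕ → Set} → Decidable P → P 0 → ∀ b → (∀ m → P m → m ≤ b) → ∃ (IsMaximum P)
maximum P? p0 zero    bound = 0 , p0 , bound
maximum P? p0 (suc b) bound with P? (suc b)
... | yes p = suc b , p , bound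
... | no ¬p = maximum P? p0 b λ m pm →
  ≤-pred (≤∧≢⇒< (bound m pm) λ { refl → ¬p pm })

-- Reachability is decided by Warshall's algorithm: Via ws u v means that
-- v is reachable from u through intermediate vertices in ws.
module _ {n} {E : Fin n → Fin n → Set} (E? : Decidable₂ E) where

  Via : List (Fin n) → Fin n → Fin n → Set
  Via []       u v = u ≡ v ⊎ E u v
  Via (w ∷ ws) u v = Via ws u v ⊎ (Via ws u w × Via ws w v)

  via? : ∀ ws → Decidable₂ (Via ws)
  via? []       u v = (u ≟ᶠ v) ⊎-dec E? u v
  via? (w ∷ ws) u v = via? ws u v ⊎-dec (via? ws u w ×-dec via? ws w v)

  via-trans : ∀ ws {u x v} → x ∈ˡ ws → Via ws u x → Via ws x v → Via ws u v
  via-trans (w ∷ ws) (here refl) p q = inj₂ (to p , from q)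
    where
    to : ∀ {u} → Via (w ∷ ws) u w → Via ws u w
    to (inj₁ p)       = p
    to (inj₂ (p , _)) = p
    from : ∀ {v} → Via (w ∷ ws) w v → Via ws w v
    from (inj₁ p)       = p
    from (inj₂ (_ , p)) = p
  via-trans (w ∷ ws) (there x∈) (inj₁ p)       (inj₁ q)       = inj₁ (via-trans ws x∈ p q)
  via-trans (w ∷ ws) (there x∈) (inj₁ p)       (inj₂ (q , r)) = inj₂ (via-trans ws x∈ p q , r)
  via-trans (w ∷ ws) (there x∈) (inj₂ (p , q)) (inj₁ r)       = inj₂ (p , via-trans ws x∈ q r)
  via-trans (w ∷ ws) (there x∈) (inj₂ (p , _)) (inj₂ (_ , r)) = inj₂ (p , r)

  via-base : ∀ ws {u v} → u ≡ v ⊎ E u v → Via ws u v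
  via-base []       p = p
  via-base (_ ∷ ws) p = inj₁ (via-base ws p)

  via⇒star : ∀ ws {u v} → Via ws u v → Star E u v
  via⇒star []       (inj₁ refl)    = ε
  via⇒star []       (inj₂ e)       = e ◅ ε
  via⇒star (_ ∷ ws) (inj₁ p)       = via⇒star ws p
  via⇒star (_ ∷ ws) (inj₂ (p , q)) = via⇒star ws p ◅◅ via⇒star ws q

  star⇒via : ∀ {u v} → Star E u v → Via (allFin n) u v
  star⇒via ε       = via-base (allFin n) (inj₁ refl)
  star⇒via (e ◅ s) = via-trans (allFin n) (∈-allFin _) (via-base (allFin n) (inj₂ e)) (star⇒via s)

  star? : Decidable₂ (Star E)
  star? u v = map′ (via⇒star (allFin n)) star⇒via (via? (allFin n) u v)

stronglyConnected? : ∀ {n} (V : Subset n) (A : ArcSet n) → Dec (StronglyConnected V A)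
stronglyConnected? V A = all? λ u → all? λ v →
  (u ∈? V) →-dec ((v ∈? V) →-dec star? (λ x y → combine x y ∈? A) u v)

arcCutOfSize? : ∀ {n} (D : Digraph n) → Decidable (ArcCutOfSize D)
arcCutOfSize? {n} D m = anySubset? λ A →
  (A ⊆? arcs D) ×-dec ((∣ A ∣ ≟ m) ×-dec ¬? (stronglyConnected? {n} ⊤ (arcs D ─ A)))

allArcsCut : ∀ {n} (D : Digraph n) → 2 ≤ n → ArcCutOfSize D ∣ arcs D ∣
allArcsCut {n} D (s≤s (s≤s _)) =
  arcs D , (λ x → x) , refl , λ st → noWalk (st zero (suc zero) ∈⊤ ∈⊤)
  where
  ∉p─p : ∀ {n x} (p : Subset n) → x ∉ p ─ p
  ∉p─p (inside  ∷ p) (there x∈) = ∉p─p p x∈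
  ∉p─p (outside ∷ p) (there x∈) = ∉p─p p x∈
  noWalk : ¬ Star (Arc {n} (arcs D ─ arcs D)) zero (suc zero)
  noWalk (e ◅ _) = ∉p─p (arcs D) e

λ-exists : ∀ {n} (D : Digraph n) → 2 ≤ n → ∃ (Is-λ D)
λ-exists D 2≤n = minimum (arcCutOfSize? D) ∣ arcs D ∣ (allArcsCut D 2≤n)

anySubgraph? : ∀ {n} {P : Subgraph n → Set} → Decidable P → Dec (∃ P)
anySubgraph? P? = map′
  (λ (V , A , p) → mkSubgraph V A , p)
  (λ (H , p) → vertices H , arcsOf H , p)
  (anySubset? λ V → anySubset? λ A → P? (mkSubgraph V A))

anyFamily? : ∀ {n} m {P : Vec (Subgraph n) m → Set} → Decidable P → Dec (∃ P)
anyFamily? zero    P? = map′ (λ p → [] , p) (λ { ([] , p) → p }) (P? [])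
anyFamily? (suc m) P? = map′
  (λ (H , Hs , p) → H ∷ Hs , p)
  (λ { (H ∷ Hs , p) → H , Hs , p })
  (anySubgraph? λ H → anyFamily? m λ Hs → P? (H ∷ Hs))

packingOfSize? : ∀ {n} (D : Digraph n) S → Decidable (PackingOfSize D S)
packingOfSize? {n} D S m = map′
  (λ (Hs , p) → lookup Hs , p)
  (λ (H , p , q) → tabulate H ,
    (λ i → subst Good (sym (lookup∘tabulate H i)) (p i)) ,
    (λ i j i≢j → subst₂ ArcDisjoint (sym (lookup∘tabulate H i)) (sym (lookup∘tabulate H j)) (q i j i≢j)))
  (anyFamily? m λ Hs →
    all? (λ i → good? (lookup Hs i)) ×-dec
    all? λ i → all? λ j → ¬? (i ≟ᶠ j) →-dec ¬? (nonempty? _))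
  where
  Good : Subgraph n → Set
  Good H = H IsSubgraphOf D × StrongSubgraph H × S ⊆ vertices H
  good? : Decidable Good
  good? H =
    (all? λ u → all? λ v → (_ ∈? arcsOf H) →-dec
      ((_ ∈? arcs D) ×-dec ((u ∈? vertices H) ×-dec (v ∈? vertices H)))) ×-dec
    (stronglyConnected? (vertices H) (arcsOf H) ×-dec (S ⊆? vertices H))

twoElements : ∀ {n} (p : Subset n) → 2 ≤ ∣ p ∣ → ∃₂ λ u v → u ∈ p × v ∈ p × u ≢ v
twoElements (outside ∷ p) 2≤ with twoElements p 2≤
... | u , v , u∈ , v∈ , u≢v = suc u , suc v , there u∈ , there v∈ , λ { refl → u≢v refl }
twoElements (inside ∷ p) (s≤s 1≤) with oneElement p 1≤
  where
  oneElement : ∀ {n} (p : Subset n) → 1 ≤ ∣ p ∣ → Nonempty p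
  oneElement (inside  ∷ p) _ = zero , here
  oneElement (outside ∷ p) h with oneElement p h
  ... | v , v∈ = suc v , there v∈
... | v , v∈ = zero , suc v , here , there v∈ , λ ()

packing-bound : ∀ {n} (D : Digraph n) S → 2 ≤ ∣ S ∣ → ∀ m → PackingOfSize D S m → m ≤ n * n
packing-bound {n} D S 2≤∣S∣ m (H , good , disjoint) with twoElements S 2≤∣S∣
... | u , v , u∈ , v∈ , u≢v = injective⇒≤ {f = proj₁ ∘ arc} injective
  where
  firstArc : ∀ {A : ArcSet n} {v} → u ≢ v → Star (Arc A) u v → Nonempty A
  firstArc u≢v ε       = contradiction refl u≢v
  firstArc u≢v (e ◅ _) = _ , e
  arc : ∀ i → Nonempty (arcsOf (H i))
  arc i with good i
  ... | _ , strong , S⊆ = firstArc u≢v (strong u v (S⊆ u∈) (S⊆ v∈))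
  injective : ∀ {i j} → proj₁ (arc i) ≡ proj₁ (arc j) → i ≡ j
  injective {i} {j} eq with i ≟ᶠ j
  ... | yes i≡j = i≡j
  ... | no  i≢j = contradiction
    (_ , x∈p∩q⁺ (proj₂ (arc i) , subst (_∈ arcsOf (H j)) (sym eq) (proj₂ (arc j))))
    (disjoint i j i≢j)

λS-exists : ∀ {n} (D : Digraph n) S → 2 ≤ ∣ S ∣ → ∃ (Is-λS D S)
λS-exists {n} D S 2≤∣S∣ =
  maximum (packingOfSize? D S) ((λ ()) , (λ ()) , λ ()) (n * n) (packing-bound D S 2≤∣S∣)

subsetOfSize : ∀ {n k} → k ≤ n → ∃ λ (S : Subset n) → ∣ S ∣ ≡ k
subsetOfSize {zero}  z≤n = [] , refl
subsetOfSize {suc n} z≤n with subsetOfSize {n} z≤n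
... | S , eq = outside ∷ S , eq
subsetOfSize (s≤s k≤n) with subsetOfSize k≤n
... | S , eq = inside ∷ S , cong suc eq

λk-exists : ∀ {n} (D : Digraph n) k → 2 ≤ k → k ≤ n → ∃ (Is-λk D k)
λk-exists {n} D k 2≤k k≤n with subsetOfSize k≤n
... | S₀ , eq₀ with λS-exists D S₀ (subst (2 ≤_) (sym eq₀) 2≤k)
... | l₀ , isl₀ = minimum (λ m → anySubset? λ S → value? S m) l₀ (S₀ , eq₀ , isl₀)
  where
  value? : ∀ S m → Dec (∣ S ∣ ≡ k × Is-λS D S m)
  value? S m with ∣ S ∣ ≟ k
  ... | no  ≢k = no (≢k ∘ proj₁)
  ... | yes ≡k with λS-exists D S (subst (2 ≤_) (sym ≡k) 2≤k)
  ... | l , p , max = map′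
    (λ { refl → ≡k , p , max })
    (λ (_ , q , max′) → ≤-antisym (max′ l p) (max m q))
    (l ≟ m)

-- λ(D); a bare λ is reserved syntax.
λᵃ : ∀ {n} (D : Digraph n) → 2 ≤ n → ℕ
λᵃ D 2≤n = proj₁ (λ-exists D 2≤n)

λₖ : ∀ {n} (D : Digraph n) (k : ℕ) → 2 ≤ k → k ≤ n → ℕ
λₖ D k 2≤k k≤n = proj₁ (λk-exists D k 2≤k k≤n)

{-# OPTIONS --safe #-}

-- Let A be a minimum arc cut and let v be unreachable from u in D − A. Every
-- strong subgraph containing u and v has a walk from u to v, hence an arc of A,
-- so a packing for any S ∋ u, v injects into A and λ_k(D) ≤ λ_S(D) ≤ ∣A∣ = λ(D).
-- Equality holds for the bidirected star: D itself is a packing of size 1, and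
-- deleting the only arc leaving a leaf destroys strong connectivity.
module Submission where

open import Defs
open import Data.Bool using (Bool; true; false)
open import Data.Fin using (Fin; zero; suc; combine; remQuot)
open import Data.Fin.Properties using (remQuot-combine; injective⇒≤; ¬∀⟶∃¬; all?; suc-injective) renaming (_≟_ to _≟ᶠ_)
open import Data.Fin.Subset using (Subset; inside; outside; _∈_; _∉_; _⊆_; _∪_; _─_; ∣_∣; ⊤; ⁅_⁆; Nonempty; _∩_)
open import Data.Fin.Subset.Properties using (_∈?_; ∈⊤; ⊆⊤; ∣⊤∣≡n; ∣⁅x⁆∣≡1; x∈⁅x⁆; x∈⁅y⁆⇒x≡y; p⊆p∪q; q⊆p∪q; x∈p∩q⁺; x∈p∩q⁻; x∈p∧x∉q⇒x∈p─q; p─q⊆p; s⊆s; out⊆)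
open import Data.Nat using (ℕ; suc; _≤_; _≤?_; z≤n; s≤s; _+_; _*_; _∸_)
open import Data.Nat.Properties using (≤-trans; ≤-antisym; ≰⇒>; +-suc; m≤n⇒m≤1+n)
open import Data.Product using (Σ; ∃; ∃₂; _×_; _,_; proj₁; proj₂; uncurry)
open import Data.Sum using (_⊎_; inj₁; inj₂)
open import Data.Vec using ([]; _∷_; lookup; tabulate)
open import Data.Vec.Base using (here; there)
open import Data.Vec.Properties using (lookup∘tabulate; lookup⇒[]=; []=⇒lookup)
open import Function using (_∘_)
open import Relation.Binary.Construct.Closure.ReflexiveTransitive using (Star; ε; _◅_)
open import Relation.Binary.PropositionalEquality using (_≡_; refl; sym; trans; cong; subst; subst₂)
open import Relation.Nullary using (¬_; Dec; yes; no; contradiction)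
open import Relation.Nullary.Decidable using (decidable-stable)

-- The number of elements of `p` below `x`. It turns an injective choice of elements of `p` into an
-- injection to `Fin ∣ p ∣`, from which a cardinality bound follows.
rank : ∀ {n x} {p : Subset n} → x ∈ p → Fin ∣ p ∣
rank here                           = zero
rank {p = inside  ∷ _} (there x∈p) = suc (rank x∈p)
rank {p = outside ∷ _} (there x∈p) = rank x∈p

rank-injective : ∀ {n x y} {p : Subset n} (x∈p : x ∈ p) (y∈p : y ∈ p) →
  rank x∈p ≡ rank y∈p → x ≡ y
rank-injective here here _ = refl
rank-injective {p = inside  ∷ _} (there x∈p) (there y∈p) eq =
  cong suc (rank-injective x∈p y∈p (suc-injective eq))
rank-injective {p = outside ∷ _} (there x∈p) (there y∈p) eq =
  cong suc (rank-injective x∈p y∈p eq)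

⊆-extend : ∀ {n k} (p : Subset n) → ∣ p ∣ ≤ k → k ≤ n → ∃ λ q → p ⊆ q × ∣ q ∣ ≡ k
⊆-extend [] _ z≤n = [] , (λ x → x) , refl
⊆-extend (inside ∷ p) (s≤s p≤k) (s≤s k≤n) with ⊆-extend p p≤k k≤n
... | q , p⊆q , eq = inside ∷ q , s⊆s p⊆q , cong suc eq
⊆-extend {suc n} {k} (outside ∷ p) p≤k k≤1+n with k ≤? n
... | yes k≤n with ⊆-extend p p≤k k≤n
...   | q , p⊆q , eq = outside ∷ q , out⊆ p⊆q , eq
-- Here `k` must be `suc n`, and only the full set has that size.
⊆-extend {suc n} {k} (outside ∷ p) p≤k k≤1+n | no k≰n =
  ⊤ , ⊆⊤ , trans (∣⊤∣≡n (suc n)) (≤-antisym (≰⇒> k≰n) k≤1+n)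

∣p∪q∣≤∣p∣+∣q∣ : ∀ {n} (p q : Subset n) → ∣ p ∪ q ∣ ≤ ∣ p ∣ + ∣ q ∣
∣p∪q∣≤∣p∣+∣q∣ []            []            = z≤n
∣p∪q∣≤∣p∣+∣q∣ (outside ∷ p) (outside ∷ q) = ∣p∪q∣≤∣p∣+∣q∣ p q
∣p∪q∣≤∣p∣+∣q∣ (outside ∷ p) (inside  ∷ q)
  rewrite +-suc ∣ p ∣ ∣ q ∣ = s≤s (∣p∪q∣≤∣p∣+∣q∣ p q)
∣p∪q∣≤∣p∣+∣q∣ (inside  ∷ p) (outside ∷ q) = s≤s (∣p∪q∣≤∣p∣+∣q∣ p q)
∣p∪q∣≤∣p∣+∣q∣ (inside  ∷ p) (inside  ∷ q)
  rewrite +-suc ∣ p ∣ ∣ q ∣ = s≤s (m≤n⇒m≤1+n (∣p∪q∣≤∣p∣+∣q∣ p q))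

x∈p─q⇒x∉q : ∀ {n x} (p q : Subset n) → x ∈ p ─ q → x ∉ q
x∈p─q⇒x∉q (_ ∷ p) (_       ∷ q) (there x∈p─q) (there x∈q) = x∈p─q⇒x∉q p q x∈p─q x∈q

∣⁅x⁆∪⁅y⁆∣≤2 : ∀ {n} (x y : Fin n) → ∣ ⁅ x ⁆ ∪ ⁅ y ⁆ ∣ ≤ 2
∣⁅x⁆∪⁅y⁆∣≤2 x y = subst₂ (λ a b → ∣ ⁅ x ⁆ ∪ ⁅ y ⁆ ∣ ≤ a + b)
  (∣⁅x⁆∣≡1 x) (∣⁅x⁆∣≡1 y) (∣p∪q∣≤∣p∣+∣q∣ ⁅ x ⁆ ⁅ y ⁆)

-- Supplies, for a pair separated by a cut, a set `S` at which λ_k(D) is compared with λ_S(D).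
subsetContainingPair : ∀ {n k} (u v : Fin n) → 2 ≤ k → k ≤ n →
  ∃ λ S → u ∈ S × v ∈ S × ∣ S ∣ ≡ k
subsetContainingPair u v 2≤k k≤n
  with S , ⊆S , eq ← ⊆-extend (⁅ u ⁆ ∪ ⁅ v ⁆) (≤-trans (∣⁅x⁆∪⁅y⁆∣≤2 u v) 2≤k) k≤n
  = S , ⊆S (p⊆p∪q ⁅ v ⁆ (x∈⁅x⁆ u)) , ⊆S (q⊆p∪q ⁅ u ⁆ ⁅ v ⁆ (x∈⁅x⁆ v)) , eq

reachable? : ∀ {n} (A : ArcSet n) (u v : Fin n) → Dec (Star (Arc {n} A) u v)
reachable? A = star? (λ x y → combine x y ∈? A)

-- Reachability on a finite vertex set is decidable, so the negated universal statement yields an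
-- explicit pair.
¬strong⇒unreachable : ∀ {n} (D : Digraph n) → ¬ Strong D →
  ∃₂ λ u v → ¬ Star (Arc {n} (arcs D)) u v
¬strong⇒unreachable {n} D ¬strong
  with u , ¬fromU ← ¬∀⟶∃¬ n _ (λ u → all? (reachable? (arcs D) u)) (λ st → ¬strong λ u v _ _ → st u v)
  with v , ¬reach ← ¬∀⟶∃¬ n _ (reachable? (arcs D) u) ¬fromU
  = u , v , ¬reach

-- Follow the walk until it first uses an arc of `A`; if it never does, all its arcs survive in
-- `C ─ A`. In the application `B` is the arc set of a packed subgraph and `C` that of `D`.
walk-avoids-or-meets : ∀ {n} {B C : ArcSet n} (A : ArcSet n) →
  (∀ {x y} → Arc {n} B x y → Arc {n} C x y) →
  ∀ {u v} → Star (Arc {n} B) u v → Star (Arc {n} (C ─ A)) u v ⊎ Nonempty (B ∩ A)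
walk-avoids-or-meets A B⊆C ε = inj₁ ε
walk-avoids-or-meets {n} A B⊆C (_◅_ {i = x} {j = y} e w) with combine x y ∈? A
... | yes e∈A = inj₂ (_ , x∈p∩q⁺ (e , e∈A))
... | no  e∉A with walk-avoids-or-meets {n} A B⊆C w
...   | inj₁ w′   = inj₁ (x∈p∧x∉q⇒x∈p─q (B⊆C e) e∉A ◅ w′)
...   | inj₂ meet = inj₂ meet

packing≤cut : ∀ {n} (D : Digraph n) (A : ArcSet n) {S u v} →
  ¬ Star (Arc {n} (arcs D ─ A)) u v → u ∈ S → v ∈ S →
  ∀ m → PackingOfSize D S m → m ≤ ∣ A ∣
packing≤cut {n} D A {u = u} {v} unreachable u∈S v∈S m (H , good , disjoint) =
  injective⇒≤ {f = rank ∘ inCut} injective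
  where
  meet : ∀ i → Nonempty (arcsOf (H i) ∩ A)
  meet i with sub , strong , S⊆ ← good i
    with walk-avoids-or-meets {n} A (proj₁ ∘ sub _ _) (strong u v (S⊆ u∈S) (S⊆ v∈S))
  ... | inj₁ w  = contradiction w unreachable
  ... | inj₂ ne = ne

  inSubgraph : ∀ i → proj₁ (meet i) ∈ arcsOf (H i)
  inSubgraph i = proj₁ (x∈p∩q⁻ _ _ (proj₂ (meet i)))

  inCut : ∀ i → proj₁ (meet i) ∈ A
  inCut i = proj₂ (x∈p∩q⁻ (arcsOf (H i)) A (proj₂ (meet i)))

  injective : ∀ {i j} → rank (inCut i) ≡ rank (inCut j) → i ≡ j
  -- Equal ranks mean that one arc of `A` was chosen for both indices, so `H i` and `H j` would
  -- share it.
  injective {i} {j} eq = decidable-stable (i ≟ᶠ j) λ i≢j →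
    disjoint i j i≢j (_ , x∈p∩q⁺ (inSubgraph i ,
      subst (_∈ arcsOf (H j)) (sym (rank-injective (inCut i) (inCut j) eq)) (inSubgraph j)))

λₖ≤λᵃ : ∀ (n k : ℕ) (D : Digraph n) (2≤k : 2 ≤ k) (k≤n : k ≤ n) →
  λₖ D k 2≤k k≤n ≤ λᵃ D (≤-trans 2≤k k≤n)
λₖ≤λᵃ n k D 2≤k k≤n
  -- `λᵃ` is the first component of this existence proof, so matching `refl` turns the right side of
  -- the goal into `∣ A ∣`.
  with _ , (A , _ , refl , ¬strong) , _ ← λ-exists D (≤-trans 2≤k k≤n)
  with _ , _ , λₖ-least ← λk-exists D k 2≤k k≤n
  with u , v , unreachable ← ¬strong⇒unreachable (deleteArcs D A) ¬strong
  with S , u∈S , v∈S , refl ← subsetContainingPair u v 2≤k k≤n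
  with l , isλS@(packing , _) ← λS-exists D S 2≤k
  = ≤-trans (λₖ-least l (S , refl , isλS)) (packing≤cut D A unreachable u∈S v∈S l packing)

-- The minimum is attained at some `S`, and for that `S` the whole of `D` is a packing with one
-- member.
strong⇒1≤λₖ : ∀ {n k} (D : Digraph n) (2≤k : 2 ≤ k) (k≤n : k ≤ n) →
  Strong D → 1 ≤ λₖ D k 2≤k k≤n
strong⇒1≤λₖ {k = k} D 2≤k k≤n strong
  with _ , (S , _ , _ , λS-greatest) , _ ← λk-exists D k 2≤k k≤n
  = λS-greatest 1
      ( (λ _ → mkSubgraph ⊤ (arcs D))
      , (λ _ → (λ _ _ e → e , ∈⊤ , ∈⊤) , strong , ⊆⊤)
      , λ { zero zero 0≢0 → contradiction refl 0≢0 })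

-- The bidirected star with centre `zero`.
starAdjacent : ∀ {n} → Fin n → Fin n → Bool
starAdjacent zero    zero    = false
starAdjacent zero    (suc _) = true
starAdjacent (suc _) zero    = true
starAdjacent (suc _) (suc _) = false

starArcs : ∀ n → ArcSet n
starArcs n = tabulate (uncurry starAdjacent ∘ remQuot n)

lookup-starArcs : ∀ {n} (u v : Fin n) → lookup (starArcs n) (combine u v) ≡ starAdjacent u v
lookup-starArcs {n} u v = trans
  (lookup∘tabulate _ (combine u v)) (cong (uncurry starAdjacent) (remQuot-combine u v))

starArc⁺ : ∀ {n} (u v : Fin n) → starAdjacent u v ≡ true → Arc {n} (starArcs n) u v
starArc⁺ u v adj = lookup⇒[]= (combine u v) _ (trans (lookup-starArcs u v) adj)

starArc⁻ : ∀ {n} (u v : Fin n) → Arc {n} (starArcs n) u v → starAdjacent u v ≡ true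
starArc⁻ u v e = trans (sym (lookup-starArcs u v)) ([]=⇒lookup e)

starDigraph : ∀ n → Digraph n
starDigraph n .arcs = starArcs n
starDigraph n .loopless u e with u | starArc⁻ u u e
... | zero  | ()
... | suc _ | ()

-- Gives the lower bound 1, and keeps the equality case nontrivial: for a digraph that is not strong
-- both numbers are 0.
starDigraph-strong : ∀ n → Strong (starDigraph n)
starDigraph-strong n u v _ _ = walk u v
  where
  walk : ∀ {n} (u v : Fin n) → Star (Arc {n} (starArcs n)) u v
  walk zero    zero    = ε
  walk zero    (suc v) = starArc⁺ zero (suc v) refl ◅ ε
  walk (suc u) zero    = starArc⁺ (suc u) zero refl ◅ ε
  walk (suc u) (suc v) = starArc⁺ (suc u) zero refl ◅ starArc⁺ zero (suc v) refl ◅ ε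

starDigraph-cut : ∀ {n} → 2 ≤ n → ArcCutOfSize (starDigraph n) 1
starDigraph-cut {n} (s≤s (s≤s _)) =
  ⁅ leafArc ⁆ , leafArc⊆ , ∣⁅x⁆∣≡1 leafArc , λ st → noWalk (st leaf zero ∈⊤ ∈⊤)
  where
  leaf : Fin n
  leaf = suc zero

  leafArc : Fin (n * n)
  leafArc = combine leaf (zero {n = n ∸ 1})

  leafArc⊆ : ⁅ leafArc ⁆ ⊆ starArcs n
  leafArc⊆ x∈ with refl ← x∈⁅y⁆⇒x≡y leafArc x∈ = starArc⁺ leaf zero refl

  noWalk : ¬ Star (Arc {n} (starArcs n ─ ⁅ leafArc ⁆)) leaf zero
  -- The first arc of the walk either enters the centre, and was deleted, or ends outside it, and is
  -- no arc of the star.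
  noWalk (_◅_ {j = zero}  e _) = x∈p─q⇒x∉q (starArcs n) ⁅ leafArc ⁆ e (x∈⁅x⁆ leafArc)
  noWalk (_◅_ {j = suc w} e _) with () ← starArc⁻ leaf (suc w) (p─q⊆p (starArcs n) ⁅ leafArc ⁆ e)

starDigraph-λₖ≡λᵃ : ∀ (n k : ℕ) (2≤k : 2 ≤ k) (k≤n : k ≤ n) →
  λₖ (starDigraph n) k 2≤k k≤n ≡ λᵃ (starDigraph n) (≤-trans 2≤k k≤n)
starDigraph-λₖ≡λᵃ n k 2≤k k≤n = ≤-antisym (λₖ≤λᵃ n k (starDigraph n) 2≤k k≤n)
  -- The reverse inequality passes through 1, the size of the leaf cut.
  (≤-trans (λ-least 1 (starDigraph-cut 2≤n))
           (strong⇒1≤λₖ (starDigraph n) 2≤k k≤n (starDigraph-strong n)))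
  where
  2≤n     = ≤-trans 2≤k k≤n
  λ-least = proj₂ (proj₂ (λ-exists (starDigraph n) 2≤n))

theorem3p7 : (∀ (n k : ℕ) (D : Digraph n) (2≤k : 2 ≤ k) (k≤n : k ≤ n) →
    λₖ D k 2≤k k≤n ≤ λᵃ D (≤-trans 2≤k k≤n))
    ×
    (∀ (n k : ℕ) (2≤k : 2 ≤ k) (k≤n : k ≤ n) →
    Σ (Digraph n) λ D → Strong D × λₖ D k 2≤k k≤n ≡ λᵃ D (≤-trans 2≤k k≤n))
theorem3p7 = λₖ≤λᵃ , λ n k 2≤k k≤n →
  starDigraph n , starDigraph-strong n , starDigraph-λₖ≡λᵃ n k 2≤k k≤n
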